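{- Let $G$ be an edge-colored graph on $n$ vertices with $\delta^c(G)\geq \frac{n+1}{2}$. (i) If $n\geq 5$, then $G$ contains two rainbow triangles sharing one common edge. (ii) If $n\geq 13$, then $G$ contains two rainbow triangles sharing one common vertex.
   Context: An edge-colored graph is a simple graph $G$ with a coloring $c:E(G)\to\mathbb{N}$ of its edges (not necessarily proper). For a vertex $v$, the color degree $d^c(v)$ is the number of distinct colors appearing on edges incident with $v$, and $\delta^c(G)=\min\{d^c(v):v\in V(G)\}$. A subgraph is rainbow if all of its edges have pairwise distinct colors. -}

module Defs where

open import Data.Nat using (ℕ; _≟_)
open import Data.Fin using (Fin)
open import Data.Fin.Properties using () renaming (_≟_ to _≟ᶠ_)
open import Data.List using (List; length; filter; map; deduplicate; allFin)
open import Data.Bool using (Bool; true; false; T)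
open import Relation.Binary.PropositionalEquality using (_≡_; _≢_)
open import Relation.Nullary.Decidable using (T?)
open import Data.Product using (_×_)

-- A simple graph on vertex set Fin n (given by a Boolean adjacency matrix,
-- symmetric and loopless) together with an edge colouring c.  The colour
-- c u v is only meaningful when u and v are adjacent; it is required to be
-- symmetric so that c is a function on (unordered) edges.
record EdgeColoredGraph (n : ℕ) : Set where
  field
    adj      : Fin n → Fin n → Bool
    adj-sym  : ∀ u v → adj u v ≡ adj v u
    adj-irr  : ∀ v → adj v v ≡ false
    col      : Fin n → Fin n → ℕ
    col-sym  : ∀ u v → col u v ≡ col v u

open EdgeColoredGraph public

Adj : ∀ {n} → EdgeColoredGraph n → Fin n → Fin n → Set
Adj G u v = T (adj G u v)

neighbours : ∀ {n} → EdgeColoredGraph n → Fin n → List (Fin n)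
neighbours {n} G v = filter (λ u → T? (adj G v u)) (allFin n)

colorDegree : ∀ {n} → EdgeColoredGraph n → Fin n → ℕ
colorDegree G v = length (deduplicate _≟_ (map (col G v) (neighbours G v)))

-- x y z form a rainbow triangle: pairwise adjacent (hence distinct, as G is
-- loopless) with three pairwise distinct edge colours
RainbowTriangle : ∀ {n} → EdgeColoredGraph n → Fin n → Fin n → Fin n → Set
RainbowTriangle G x y z =
  Adj G x y × Adj G y z × Adj G x z ×
  col G x y ≢ col G y z × col G y z ≢ col G x z × col G x y ≢ col G x z

{-# OPTIONS --safe #-}

-- Let D(x) be the degree of x, and count ordered triples of vertices. A triangle that is
-- not rainbow has two equally coloured edges at some vertex x; as x sees at least (n+1)/2
-- colours, there are few such pairs at x. On the other hand an edge xy lies in at least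
-- D(x) + D(y) - n triangles. Comparing the two counts, the number of ordered rainbow
-- triangles is at least the sum of the degrees, with room to spare as soon as some triangle
-- is not rainbow or some vertex is adjacent to neither end of an edge.
-- (i) If no two rainbow triangles share an edge, the sum of the degrees is also an upper
-- bound, so there is no room at all, and a vertex outside a rainbow triangle is adjacent
-- to two of its vertices, which gives a second rainbow triangle on an edge.
-- (ii) If no two rainbow triangles meet in exactly one vertex, there are at most n of them,
-- that is 6n ordered ones, whereas for n ≥ 13 all degrees are at least 7.
module Submission where

open import Defs
open import Data.Nat using (ℕ; zero; suc; _≤_; _<_; _+_; _*_; _∸_; z≤n; s≤s; _≟_; _≡ᵇ_; _≤?_; >-nonZero)
open import Data.Nat.Properties hiding (_≟_; _≤?_)
open import Data.Nat.ListAction using () renaming (sum to sumˡ)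
open import Data.Nat.Tactic.RingSolver using (solve-∀)
open import Data.Fin using (Fin; zero; suc; fromℕ<)
open import Data.Fin.Properties using (any?) renaming (_≟_ to _≟ᶠ_)
open import Data.Bool using (Bool; true; false; T; _∧_; not)
open import Data.List using (List; []; _∷_; length; filter; map; deduplicate; tabulate)
open import Data.List.Properties using (length-filter; filter-notAll)
open import Data.List.Membership.Propositional using (_∈_; _∉_)
open import Data.List.Membership.Propositional.Properties
  using (∈-map⁺; ∈-filter⁺; ∈-tabulate⁺; ∈-deduplicate⁺)
open import Data.List.Membership.DecPropositional _≟_ using (_∈?_)
open import Data.List.Relation.Unary.Any as Any using (here; there)
open import Data.Product using (_×_; _,_; ∃-syntax; proj₁; proj₂)
open import Data.Sum using (_⊎_; inj₁; inj₂)
open import Data.Empty using (⊥)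
open import Function using (_∘_; id; mk⇔)
open import Relation.Nullary using (¬_; Dec; yes; no; does; contradiction)
open import Relation.Nullary.Decidable using (T?; ¬?; does-⇔; _×-dec_; _⊎-dec_; dec-true; dec-false;
                                            decidable-stable)
open import Relation.Binary.PropositionalEquality
open import Algebra.Properties.Semiring.Sum +-*-semiring
  using (sum; sum-syntax; sum-cong-≗; ∑-distrib-+; ∑-comm; *-distribˡ-sum; *-distribʳ-sum)

-- Finite sums and indicators.

sum-mono : ∀ {n} {f g : Fin n → ℕ} → (∀ i → f i ≤ g i) → sum f ≤ sum g
sum-mono {zero}  f≤g = z≤n
sum-mono {suc n} f≤g = +-mono-≤ (f≤g zero) (sum-mono (f≤g ∘ suc))

sum-mono-< : ∀ {n} {f g : Fin n → ℕ} → (∀ i → f i ≤ g i) → ∀ i → f i < g i → sum f < sum g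
sum-mono-< f≤g zero    lt = +-mono-<-≤ lt (sum-mono (f≤g ∘ suc))
sum-mono-< f≤g (suc i) lt = +-mono-≤-< (f≤g zero) (sum-mono-< (f≤g ∘ suc) i lt)

term≤sum : ∀ {n} (f : Fin n → ℕ) i → f i ≤ sum f
term≤sum f zero    = m≤m+n _ _
term≤sum f (suc i) = ≤-trans (term≤sum (f ∘ suc) i) (m≤n+m _ _)

sum>0⇒∃ : ∀ {n} (f : Fin n → ℕ) → 0 < sum f → ∃[ i ] 0 < f i
sum>0⇒∃ {suc n} f pos with f zero in eq
... | suc k = zero , subst (0 <_) (sym eq) (s≤s z≤n)
... | zero  with i , p ← sum>0⇒∃ (f ∘ suc) pos = suc i , p

sum-const : ∀ n c → ∑[ i < n ] c ≡ n * c
sum-const zero    c = refl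
sum-const (suc n) c = cong (c +_) (sum-const n c)

ι : Bool → ℕ
ι true  = 1
ι false = 0

ι≤1 : ∀ b → ι b ≤ 1
ι≤1 true  = ≤-refl
ι≤1 false = z≤n

ι>0⇒ : ∀ {P : Set} (P? : Dec P) → 0 < ι (does P?) → P
ι>0⇒ (yes p) _ = p

-- Equally coloured edges at a single vertex.

module ColourClasses {X : Set} (a : X → Bool) (c : X → ℕ) (r : X → X → Bool)
                     (r-irr : ∀ x → r x x ≡ false) where

  -- With `a` and `c` the adjacency and the colours at a vertex v, and `r` the adjacency of the
  -- graph, this marks a triangle at v whose two edges at v have the same colour. The conjunct
  -- `r y z` also keeps a neighbour from clashing with itself.
  clash : X → X → ℕ
  clash y z = ι (a y ∧ a z ∧ r y z ∧ does (c y ≟ c z))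

  degree : ∀ {m} → (Fin m → X) → ℕ
  degree f = sum (λ y → ι (a (f y)))

  clashes : ∀ {m} → (Fin m → X) → ℕ
  clashes f = sum (λ y → sum (λ z → clash (f y) (f z)))

  multiplicity : ∀ {m} → ℕ → (Fin m → X) → ℕ
  multiplicity γ f = sum (λ y → ι (a (f y) ∧ does (γ ≟ c (f y))))

  colours : ∀ {m} → (Fin m → X) → List ℕ
  colours f = map c (filter (T? ∘ a) (tabulate f))

  clash-irr : ∀ x → clash x x ≡ 0
  clash-irr x with a x | r-irr x
  ... | false | eq = refl
  ... | true  | eq rewrite eq = refl

  clash-≤ˡ : ∀ x y → clash x y ≤ ι (a x) * ι (a y ∧ does (c x ≟ c y))
  clash-≤ˡ x y with a x | a y | r x y | does (c x ≟ c y)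
  ... | false | _     | _     | _     = z≤n
  ... | true  | false | _     | _     = z≤n
  ... | true  | true  | false | _     = z≤n
  ... | true  | true  | true  | false = z≤n
  ... | true  | true  | true  | true  = ≤-refl

  does-sym : ∀ (p q : ℕ) → does (p ≟ q) ≡ does (q ≟ p)
  does-sym p q = does-⇔ (mk⇔ sym sym) (p ≟ q) (q ≟ p)

  clash-≤ʳ : ∀ x y → clash x y ≤ ι (a y) * ι (a x ∧ does (c y ≟ c x))
  clash-≤ʳ x y rewrite does-sym (c y) (c x) with a x | a y | r x y | does (c x ≟ c y)
  ... | false | _     | _     | _     = z≤n
  ... | true  | false | _     | _     = z≤n
  ... | true  | true  | false | _     = z≤n
  ... | true  | true  | true  | false = z≤n
  ... | true  | true  | true  | true  = ≤-refl

  -- The square of pairs splits into a corner, which is 0, a row, a column and the smaller square.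
  -- Forgetting `r`, row and column each count at most the later neighbours with the colour of
  -- `f zero`.
  clashes-suc : ∀ {m} (f : Fin (suc m) → X) →
    let h = ι (a (f zero)) * multiplicity (c (f zero)) (f ∘ suc) in
    clashes f ≤ h + (h + clashes (f ∘ suc))
  clashes-suc {m} f = begin
    (clash x x + S₁) + sum (λ y → clash (f (suc y)) x + sum (λ z → clash (f (suc y)) (f (suc z))))
      ≡⟨ cong₂ _+_ (cong (_+ S₁) (clash-irr x)) (∑-distrib-+ (λ y → clash (f (suc y)) x) _) ⟩
    S₁ + (S₂ + clashes (f ∘ suc))
      ≤⟨ +-mono-≤ (≤-trans (sum-mono (λ y → clash-≤ˡ x (f (suc y)))) pull)
                  (+-monoˡ-≤ _ (≤-trans (sum-mono (λ y → clash-≤ʳ (f (suc y)) x)) pull)) ⟩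
    h + (h + clashes (f ∘ suc)) ∎
    where
    open ≤-Reasoning
    x = f zero
    S₁ = sum (λ z → clash x (f (suc z)))
    S₂ = sum (λ y → clash (f (suc y)) x)
    h = ι (a x) * multiplicity (c x) (f ∘ suc)
    pull : sum (λ y → ι (a x) * ι (a (f (suc y)) ∧ does (c x ≟ c (f (suc y))))) ≤ h
    pull = ≤-reflexive (sym (*-distribˡ-sum (ι (a x)) (λ y → ι (a (f (suc y)) ∧ does (c x ≟ c (f (suc y)))))))

  ∉⇒multiplicity≡0 : ∀ {m} (f : Fin m → X) γ → γ ∉ colours f → multiplicity γ f ≡ 0
  ∉⇒multiplicity≡0 f γ γ∉ with multiplicity γ f in eq
  ... | zero  = refl
  ... | suc _ with i , p ← sum>0⇒∃ (λ y → ι (a (f y) ∧ does (γ ≟ c (f y)))) (subst (0 <_) (sym eq) (s≤s z≤n))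
              = contradiction (found i p) γ∉
    where
    found : ∀ i → 0 < ι (a (f i) ∧ does (γ ≟ c (f i))) → γ ∈ colours f
    found i p with a (f i) in ai | γ ≡ᵇ c (f i) in ci
    ... | true | true rewrite ≡ᵇ⇒≡ γ (c (f i)) (subst T (sym ci) _) =
      ∈-map⁺ c (∈-filter⁺ (T? ∘ a) (∈-tabulate⁺ i) (subst T (sym ai) _))

  -- e is the number of neighbours whose colour recurs later in the list: clashes are
  -- most numerous when all of them fall into a single colour class, of size e + 1.
  excess : ∀ {m} (f : Fin m → X) → ∃[ e ]
    (length (deduplicate _≟_ (colours f)) + e ≤ degree f ×
     clashes f ≤ suc e * e ×
     (∀ γ → multiplicity γ f ≤ suc e))
  excess {zero}  f = 0 , z≤n , z≤n , λ γ → z≤n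
  excess {suc m} f with excess (f ∘ suc) | clashes-suc f | ∉⇒multiplicity≡0 (f ∘ suc) (c (f zero))
  ... | e , k+e≤ , cl , mu | step | absent with a (f zero)
  ... | false = e , k+e≤ , ≤-trans step cl , mu
  ... | true with c (f zero) ∈? colours (f ∘ suc)
  -- A repeated colour leaves the number of colours unchanged, so `e` grows by one. By the uniform
  -- bound `mu`, row and column add at most `suc e` each, which is the gap between consecutive
  -- values of `suc e * e`.
  ... | yes c₀∈ = suc e , k′ , ≤-trans step (≤-trans (+-mono-≤ h≤ (+-mono-≤ h≤ cl)) (≤-reflexive (rhs e))) , λ γ → +-mono-≤ (ι≤1 _) (mu γ)
    where
    ds = deduplicate _≟_ (colours (f ∘ suc))
    c₀ = c (f zero)
    k≤ : suc (length (filter (¬? ∘ (c₀ ≟_)) ds)) ≤ length ds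
    k≤ = filter-notAll (¬? ∘ (c₀ ≟_)) ds (Any.map (λ eq ¬eq → ¬eq eq) (∈-deduplicate⁺ _≟_ c₀∈))
    k′ : suc (length (filter (¬? ∘ (c₀ ≟_)) ds)) + suc e ≤ suc (degree (f ∘ suc))
    k′ = ≤-trans (+-monoˡ-≤ (suc e) k≤) (subst (_≤ suc (degree (f ∘ suc))) (sym (+-suc _ e)) (s≤s k+e≤))
    h≤ : 1 * multiplicity c₀ (f ∘ suc) ≤ suc e
    h≤ = ≤-trans (≤-reflexive (*-identityˡ _)) (mu c₀)
    rhs : ∀ e → suc e + (suc e + suc e * e) ≡ suc (suc e) * suc e
    rhs = solve-∀
  -- A fresh colour has no later occurrence: no clash is added, and its multiplicity becomes 1.
  ... | no c₀∉ = e , s≤s (≤-trans (+-monoˡ-≤ e (length-filter _ ds)) k+e≤)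
             , ≤-trans step (subst (λ h → 1 * h + (1 * h + clashes (f ∘ suc)) ≤ suc e * e) (sym (absent c₀∉)) cl) , mu′
    where
    ds = deduplicate _≟_ (colours (f ∘ suc))
    mu′ : ∀ γ → ι (does (γ ≟ c (f zero))) + multiplicity γ (f ∘ suc) ≤ suc e
    mu′ γ with γ ≡ᵇ c (f zero) in eq
    ... | true rewrite ≡ᵇ⇒≡ γ (c (f zero)) (subst T (sym eq) _) =
      subst (λ h → 1 + h ≤ suc e) (sym (absent c₀∉)) (s≤s z≤n)
    ... | false = mu γ

-- Sums over ordered triples.

∑³ : ∀ {n} → (Fin n → Fin n → Fin n → ℕ) → ℕ
∑³ f = sum λ x → sum λ y → sum λ z → f x y z

module _ {n : ℕ} where

  private Fn = Fin n → Fin n → Fin n → ℕ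

  ∑³-cong : {f g : Fn} → (∀ x y z → f x y z ≡ g x y z) → ∑³ f ≡ ∑³ g
  ∑³-cong f≡g = sum-cong-≗ λ x → sum-cong-≗ λ y → sum-cong-≗ (f≡g x y)

  ∑³-mono : {f g : Fn} → (∀ x y z → f x y z ≤ g x y z) → ∑³ f ≤ ∑³ g
  ∑³-mono f≤g = sum-mono λ x → sum-mono λ y → sum-mono (f≤g x y)

  term≤∑³ : (f : Fn) → ∀ x y z → f x y z ≤ ∑³ f
  term≤∑³ f x y z = ≤-trans (term≤sum (f x y) z) (≤-trans (term≤sum (sum ∘ f x) y) (term≤sum _ x))

  ∑³>0⇒∃ : (f : Fn) → 0 < ∑³ f → ∃[ x ] ∃[ y ] ∃[ z ] 0 < f x y z
  ∑³>0⇒∃ f pos with x , px ← sum>0⇒∃ _ pos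
               with y , py ← sum>0⇒∃ _ px
               with z , pz ← sum>0⇒∃ _ py = x , y , z , pz

  ∑³-+ : (f g : Fn) → ∑³ (λ x y z → f x y z + g x y z) ≡ ∑³ f + ∑³ g
  ∑³-+ f g = trans
    (sum-cong-≗ λ x → trans (sum-cong-≗ λ y → ∑-distrib-+ (f x y) (g x y))
                            (∑-distrib-+ (sum ∘ f x) (sum ∘ g x)))
    (∑-distrib-+ (λ x → sum (sum ∘ f x)) (λ x → sum (sum ∘ g x)))

  ∑³-swap₁₂ : (f : Fn) → ∑³ (λ x y z → f y x z) ≡ ∑³ f
  ∑³-swap₁₂ f = ∑-comm (λ x y → sum (f y x))

  ∑³-swap₂₃ : (f : Fn) → ∑³ (λ x y z → f x z y) ≡ ∑³ f
  ∑³-swap₂₃ f = sum-cong-≗ λ x → ∑-comm (λ y z → f x z y)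

  ∑³-rotate : (f : Fn) → ∑³ (λ x y z → f z x y) ≡ ∑³ f
  ∑³-rotate f = trans (∑³-swap₂₃ (λ x y z → f y x z)) (∑³-swap₁₂ f)

-- The inequality between degree, colours and clashes.

-- Enlarging k we may assume D = k + e. Put f = 2k - (n + 1) and g = k - (e + f + 2):
-- in terms of e, f, g the difference of the two sides has nonnegative coefficients.
degree-bound : ∀ n D k e → k + e ≤ D → D < n → n + 1 ≤ 2 * k →
  n * D + D + 4 * (suc e * e) ≤ 2 * (D * D)
degree-bound n D k e k+e≤D D<n n<2k = bound
  where
  k′ = D ∸ e
  D≡ : k′ + e ≡ D
  D≡ = m∸n+n≡m (≤-trans (m≤n+m e k) k+e≤D)
  k≤k′ : k ≤ k′
  k≤k′ = ≤-trans (≤-reflexive (sym (m+n∸n≡m k e))) (∸-monoˡ-≤ e k+e≤D)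
  f = 2 * k′ ∸ (n + 1)
  f≡ : n + 1 + f ≡ 2 * k′
  f≡ = m+[n∸m]≡n (≤-trans n<2k (*-monoʳ-≤ 2 k≤k′))
  -- This makes `g` a true difference: `D < n` reads `k′ + e + 1 ≤ n`, and `n + 1 + f` is `2 * k′`.
  room : e + f + 2 ≤ k′
  room = +-cancelˡ-≤ k′ _ _ (begin
    k′ + (e + f + 2)      ≡⟨ r₁ k′ e f ⟩
    suc (k′ + e) + 1 + f  ≡⟨ cong (λ d → suc d + 1 + f) D≡ ⟩
    suc D + 1 + f         ≤⟨ +-monoˡ-≤ f (+-monoˡ-≤ 1 D<n) ⟩
    n + 1 + f             ≡⟨ f≡ ⟩
    2 * k′                ≡⟨ r₂ k′ ⟩
    k′ + k′               ∎)
    where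
    open ≤-Reasoning
    r₁ : ∀ k e f → k + (e + f + 2) ≡ suc (k + e) + 1 + f
    r₁ = solve-∀
    r₂ : ∀ k → 2 * k ≡ k + k
    r₂ = solve-∀
  g = k′ ∸ (e + f + 2)
  g≡ : e + f + 2 + g ≡ k′
  g≡ = m+[n∸m]≡n room
  n≡ : n ≡ 2 * e + f + 3 + 2 * g
  n≡ = +-cancelʳ-≡ (1 + f) _ _ (begin
    n + (1 + f)                         ≡⟨ +-assoc n 1 f ⟨
    n + 1 + f                           ≡⟨ f≡ ⟩
    2 * k′                              ≡⟨ cong (2 *_) g≡ ⟨
    2 * (e + f + 2 + g)                 ≡⟨ r e f g ⟩
    2 * e + f + 3 + 2 * g + (1 + f)     ∎)
    where
    open ≡-Reasoning
    r : ∀ e f g → 2 * (e + f + 2 + g) ≡ 2 * e + f + 3 + 2 * g + (1 + f)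
    r = solve-∀
  D≡′ : D ≡ e + f + 2 + g + e
  D≡′ = trans (sym D≡) (cong (_+ e) (sym g≡))
  difference : ∀ e f g → let D = e + f + 2 + g + e in
    (2 * e + f + 3 + 2 * g) * D + D + 4 * (suc e * e)
      + (4 * (e * f) + f * f + 2 * f + 2 * (e * g) + f * g)
    ≡ 2 * (D * D)
  difference = solve-∀
  bound : n * D + D + 4 * (suc e * e) ≤ 2 * (D * D)
  bound = subst₂ (λ n D → n * D + D + 4 * (suc e * e) ≤ 2 * (D * D)) (sym n≡) (sym D≡′)
    (≤-trans (m≤m+n _ _) (≤-reflexive (difference e f g)))

-- Lower bound for the number of rainbow triangles.

module Counting {n : ℕ} (G : EdgeColoredGraph n) where

  rainbow? : ∀ x y z → Dec (RainbowTriangle G x y z)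
  rainbow? x y z =
    T? (adj G x y) ×-dec T? (adj G y z) ×-dec T? (adj G x z) ×-dec
    ¬? (col G x y ≟ col G y z) ×-dec ¬? (col G y z ≟ col G x z) ×-dec ¬? (col G x y ≟ col G x z)

  A : Fin n → Fin n → ℕ
  A x y = ι (adj G x y)

  deg : Fin n → ℕ
  deg x = sum (A x)

  -- Indicators for ordered triples: rainbow triangles, triangles, triangles with a colour clash at
  -- the apex x, and edges xy with a vertex z adjacent to neither end. The order of the conjuncts
  -- makes `β x` definitionally the `clash` at x.
  ρ τ β κ : Fin n → Fin n → Fin n → ℕ
  ρ x y z = ι (does (rainbow? x y z))
  τ x y z = ι (adj G x y ∧ adj G y z ∧ adj G x z)
  β x y z = ι (adj G x y ∧ adj G x z ∧ adj G y z ∧ does (col G x y ≟ col G x z))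
  κ x y z = ι (adj G x y ∧ not (adj G x z) ∧ not (adj G y z))

  A-sym : ∀ x y → A x y ≡ A y x
  A-sym x y = cong ι (adj-sym G x y)

  -- Any two edges of a triangle meet, so equal colours show up as a clash at one of the three
  -- vertices; there is one `β` for each apex.
  τ≤ρ+β : ∀ x y z → τ x y z ≤ ρ x y z + (β x y z + (β y x z + β z x y))
  τ≤ρ+β x y z
    -- Symmetry reduces both sides to six Booleans, three adjacencies and three colour comparisons,
    -- so that a truth table decides.
    rewrite adj-sym G y x | adj-sym G z x | adj-sym G z y
          | col-sym G y x | col-sym G z x | col-sym G z y
          | does-⇔ (mk⇔ sym sym) (col G x z ≟ col G y z) (col G y z ≟ col G x z)
    = bool (adj G x y) (adj G y z) (adj G x z)
           (does (col G x y ≟ col G y z)) (does (col G y z ≟ col G x z)) (does (col G x y ≟ col G x z))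
    where
    bool : ∀ p q r s t u → ι (p ∧ q ∧ r) ≤
      ι (p ∧ q ∧ r ∧ not s ∧ not t ∧ not u)
      + (ι (p ∧ r ∧ q ∧ u) + (ι (p ∧ q ∧ r ∧ s) + ι (r ∧ q ∧ p ∧ t)))
    bool false _     _     _     _     _     = z≤n
    bool true  false _     _     _     _     = z≤n
    bool true  true  false _     _     _     = z≤n
    bool true  true  true  false false false = ≤-refl
    bool true  true  true  false false true  = s≤s z≤n
    bool true  true  true  false true  false = s≤s z≤n
    bool true  true  true  false true  true  = s≤s z≤n
    bool true  true  true  true  false false = s≤s z≤n
    bool true  true  true  true  false true  = s≤s z≤n
    bool true  true  true  true  true  false = s≤s z≤n
    bool true  true  true  true  true  true  = s≤s z≤n

  no-clash⇒rainbow : ∀ {x y z} → Adj G x y → Adj G y z → Adj G x z →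
    β x y z ≡ 0 → β y x z ≡ 0 → β z x y ≡ 0 → RainbowTriangle G x y z
  no-clash⇒rainbow {x} {y} {z} xy yz xz e₁ e₂ e₃ = ι>0⇒ (rainbow? x y z) (begin
    1                                             ≡⟨ τ≡1 ⟨
    τ x y z                                       ≤⟨ τ≤ρ+β x y z ⟩
    ρ x y z + (β x y z + (β y x z + β z x y))     ≡⟨ cong (ρ x y z +_) (cong₂ _+_ e₁ (cong₂ _+_ e₂ e₃)) ⟩
    ρ x y z + 0                                   ≡⟨ +-identityʳ _ ⟩
    ρ x y z                                       ∎)
    where
    open ≤-Reasoning
    τ≡1 : τ x y z ≡ 1
    τ≡1 with adj G x y | adj G y z | adj G x z
    ... | true | true | true = refl

  κ≡0⇒dominated : ∀ {x y w} → Adj G x y → κ x y w ≡ 0 → Adj G x w ⊎ Adj G y w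
  κ≡0⇒dominated {x} {y} {w} xy κ≡0 with adj G x y | adj G x w | adj G y w
  ... | true | true  | _    = inj₁ _
  ... | true | false | true = inj₂ _

  -- Inclusion-exclusion for the neighbourhoods of the ends of an edge xy. Summed over z it says
  -- that deg x + deg y - n is the number of common neighbours minus the number of vertices adjacent
  -- to neither end.
  A+A≡ : ∀ x y z → A x y * A x z + A x y * A y z + κ x y z ≡ A x y + τ x y z
  A+A≡ x y z with adj G x y | adj G y z | adj G x z
  ... | false | _     | _     = refl
  ... | true  | false | false = refl
  ... | true  | false | true  = refl
  ... | true  | true  | false = refl
  ... | true  | true  | true  = refl

  ∑deg² : ℕ
  ∑deg² = ∑[ x < n ] (deg x * deg x)

  deg²-split : ∀ x → deg x * deg x ≡ ∑[ y < n ] ∑[ z < n ] (A x y * A x z)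
  deg²-split x = trans (*-distribʳ-sum {n} (deg x) (A x)) (sum-cong-≗ λ y → *-distribˡ-sum {n} (A x y) (A x))

  -- The sum of `A+A≡` over all triples. Both products count walks of length two, by their middle
  -- vertex x or y, and so each gives the sum of squared degrees.
  triangle-count : 2 * ∑deg² + ∑³ κ ≡ n * sum deg + ∑³ τ
  triangle-count = begin
    2 * ∑deg² + ∑³ κ
      ≡⟨ cong (_+ ∑³ κ) (cong₂ _+_ first (trans (+-identityʳ _) second)) ⟩
    ∑³ (λ x y z → A x y * A x z) + ∑³ (λ x y z → A x y * A y z) + ∑³ κ
      ≡⟨ cong (_+ ∑³ κ) (∑³-+ {n} _ _) ⟨
    ∑³ (λ x y z → A x y * A x z + A x y * A y z) + ∑³ κ
      ≡⟨ ∑³-+ {n} _ _ ⟨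
    ∑³ (λ x y z → A x y * A x z + A x y * A y z + κ x y z)
      ≡⟨ ∑³-cong A+A≡ ⟩
    ∑³ (λ x y z → A x y + τ x y z)
      ≡⟨ ∑³-+ {n} _ _ ⟩
    ∑³ (λ x y z → A x y) + ∑³ τ
      ≡⟨ cong (_+ ∑³ τ) third ⟩
    n * sum deg + ∑³ τ ∎
    where
    open ≡-Reasoning
    first : ∑deg² ≡ ∑³ (λ x y z → A x y * A x z)
    first = sum-cong-≗ deg²-split
    second : ∑deg² ≡ ∑³ (λ x y z → A x y * A y z)
    second = trans first (trans (sym (∑³-swap₁₂ (λ x y z → A x y * A x z)))
               (∑³-cong λ x y z → cong (_* A y z) (A-sym y x)))
    third : ∑³ (λ x y z → A x y) ≡ n * sum deg
    third = trans (sum-cong-≗ λ x → trans (sum-cong-≗ λ y → sum-const n (A x y)) (sym (*-distribˡ-sum {n} n (A x))))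
                  (sym (*-distribˡ-sum {n} n deg))

  triangles≤ : ∑³ τ ≤ ∑³ ρ + 3 * ∑³ β
  triangles≤ = begin
    ∑³ τ ≤⟨ ∑³-mono τ≤ρ+β ⟩
    ∑³ (λ x y z → ρ x y z + (β x y z + (β y x z + β z x y)))
      ≡⟨ trans (∑³-+ {n} _ _) (cong (∑³ ρ +_) (trans (∑³-+ {n} _ _) (cong (∑³ β +_) (∑³-+ {n} (λ x y z → β y x z) _)))) ⟩
    ∑³ ρ + (∑³ β + (∑³ (λ x y z → β y x z) + ∑³ (λ x y z → β z x y)))
      ≡⟨ cong (λ s → ∑³ ρ + (∑³ β + s)) (cong₂ _+_ (∑³-swap₁₂ β) (trans (∑³-rotate β) (sym (+-identityʳ _)))) ⟩
    ∑³ ρ + 3 * ∑³ β ∎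
    where open ≤-Reasoning

  deg<n : ∀ x → deg x < n
  deg<n x = subst (deg x <_) (trans (sum-const n 1) (*-identityʳ n))
    (sum-mono-< (λ y → ι≤1 (adj G x y)) x (subst (λ b → ι b < 1) (sym (adj-irr G x)) (s≤s z≤n)))

  colorDegree≤deg : ∀ x → colorDegree G x ≤ deg x
  colorDegree≤deg x with e , k+e≤ , _ ← ColourClasses.excess (adj G x) (col G x) (adj G) (adj-irr G) id
    = ≤-trans (m≤m+n _ e) k+e≤

  module _ (large : ∀ v → n + 1 ≤ 2 * colorDegree G v) where

    -- The double sum of `β x` is `clashes` at x, so `excess` supplies the `e` that `degree-bound`
    -- asks for.
    local-bound : ∀ x → n * deg x + deg x + 4 * (∑[ y < n ] ∑[ z < n ] β x y z) ≤ 2 * (deg x * deg x)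
    local-bound x with e , k+e≤ , β≤ , _ ← ColourClasses.excess (adj G x) (col G x) (adj G) (adj-irr G) id
      = ≤-trans (+-monoʳ-≤ (n * deg x + deg x) (*-monoʳ-≤ 4 β≤))
          (degree-bound n (deg x) (colorDegree G x) e k+e≤ (deg<n x) (large x))

    local-bound-sum : n * sum deg + sum deg + 4 * ∑³ β ≤ 2 * ∑deg²
    local-bound-sum = begin
      n * sum deg + sum deg + 4 * ∑³ β
        ≡⟨ cong₂ (λ s t → s + sum deg + t) (*-distribˡ-sum {n} n deg) (*-distribˡ-sum {n} 4 _) ⟩
      sum (λ x → n * deg x) + sum deg + sum (λ x → 4 * sum (sum ∘ β x))
        ≡⟨ cong (_+ sum (λ x → 4 * sum (sum ∘ β x))) (∑-distrib-+ {n} _ deg) ⟨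
      sum (λ x → n * deg x + deg x) + sum (λ x → 4 * sum (sum ∘ β x))
        ≡⟨ ∑-distrib-+ {n} _ _ ⟨
      sum (λ x → n * deg x + deg x + 4 * sum (sum ∘ β x))
        ≤⟨ sum-mono local-bound ⟩
      sum (λ x → 2 * (deg x * deg x))
        ≡⟨ *-distribˡ-sum {n} 2 _ ⟨
      2 * ∑deg² ∎
      where open ≤-Reasoning

    -- `local-bound-sum` pays for each clash four times, while `triangles≤` charges it three times,
    -- once per apex. The fourth payment and `κ` remain as slack on the left.
    rainbow-count : sum deg + (∑³ β + ∑³ κ) ≤ ∑³ ρ
    rainbow-count = +-cancelˡ-≤ (n * sum deg + 3 * ∑³ β) _ _ (begin
      (n * sum deg + 3 * ∑³ β) + (sum deg + (∑³ β + ∑³ κ))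
        ≡⟨ r₁ (n * sum deg) (sum deg) (∑³ β) (∑³ κ) ⟩
      (n * sum deg + sum deg + 4 * ∑³ β) + ∑³ κ ≤⟨ +-monoˡ-≤ (∑³ κ) local-bound-sum ⟩
      2 * ∑deg² + ∑³ κ                          ≡⟨ triangle-count ⟩
      n * sum deg + ∑³ τ                        ≤⟨ +-monoʳ-≤ (n * sum deg) triangles≤ ⟩
      n * sum deg + (∑³ ρ + 3 * ∑³ β)           ≡⟨ r₂ (n * sum deg) (∑³ ρ) (∑³ β) ⟩
      (n * sum deg + 3 * ∑³ β) + ∑³ ρ           ∎)
      where
      open ≤-Reasoning
      r₁ : ∀ m d b k → (m + 3 * b) + (d + (b + k)) ≡ (m + d + 4 * b) + k
      r₁ = solve-∀
      r₂ : ∀ m r b → m + (r + 3 * b) ≡ (m + 3 * b) + r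
      r₂ = solve-∀

-- Sums supported on a short list.

⇒ι≡1 : ∀ {P : Set} (P? : Dec P) → P → ι (does P?) ≡ 1
⇒ι≡1 P? p = cong ι (dec-true P? p)

sum-δ : ∀ {n} (i : Fin n) c → ∑[ j < n ] (ι (does (i ≟ᶠ j)) * c) ≡ c
sum-δ {suc n} zero    c = trans (cong₂ _+_ (*-identityˡ c) (trans (sum-const n 0) (*-zeroʳ n))) (+-identityʳ c)
sum-δ {suc n} (suc i) c = sum-δ i c

-- Place a point mass `f i` at each entry i of the list. These masses dominate `f` pointwise, and
-- repeated entries only add to them.
sum-supported : ∀ {n} (f : Fin n → ℕ) (xs : List (Fin n)) → (∀ i → 0 < f i → i ∈ xs) →
  sum f ≤ sumˡ (map f xs)
sum-supported {n} f xs supp = ≤-trans (sum-mono f≤) (≤-reflexive (total xs))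
  where
  spread : List (Fin n) → Fin n → ℕ
  spread xs j = sumˡ (map (λ i → ι (does (i ≟ᶠ j)) * f i) xs)
  total : ∀ xs → sum (spread xs) ≡ sumˡ (map f xs)
  total []       = trans (sum-const n 0) (*-zeroʳ n)
  total (x ∷ xs) = trans (∑-distrib-+ {n} _ (spread xs)) (cong₂ _+_ (sum-δ x (f x)) (total xs))
  ∈⇒≤ : ∀ j {xs} → j ∈ xs → f j ≤ spread xs j
  ∈⇒≤ j (here refl) rewrite ⇒ι≡1 (j ≟ᶠ j) refl | *-identityˡ (f j) = m≤m+n (f j) _
  ∈⇒≤ j (there j∈)  = ≤-trans (∈⇒≤ j j∈) (m≤n+m _ _)
  f≤ : ∀ j → f j ≤ spread xs j
  f≤ j with f j in eq
  ... | zero  = z≤n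
  ... | suc _ = subst (_≤ spread xs j) eq (∈⇒≤ j (supp j (subst (0 <_) (sym eq) (s≤s z≤n))))

-- Upper bound when no two triangles meet in exactly one vertex.

-- Discharging: a triangle charges 3 to a vertex lying in no other triangle, and 1 to each
-- of its vertices if there is none: all triangles meeting it then live on the same four
-- vertices, so that each of these lies in at most three. Triangles at a vertex are counted as ordered pairs, so
-- the thresholds 2 and 6 stand for one and three triangles.
weight : ℕ → ℕ
weight r with r ≤? 2 | r ≤? 6
... | yes _ | _     = 3
... | no _  | yes _ = 1
... | no _  | no _  = 0

weight-small : ∀ {r} → r ≤ 2 → weight r ≡ 3
weight-small {r} r≤2 with r ≤? 2
... | yes _ = refl
... | no ¬p = contradiction r≤2 ¬p

weight-medium : ∀ {r} → r ≤ 6 → 1 ≤ weight r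
weight-medium {r} r≤6 with r ≤? 2 | r ≤? 6
... | yes _ | _     = s≤s z≤n
... | no _  | yes _ = s≤s z≤n
... | no _  | no ¬p = contradiction r≤6 ¬p

-- Both thresholds reach the same ceiling, 2 * 3 = 6 * 1. The product is the whole charge that a
-- vertex receives.
*-weight-≤ : ∀ r → r * weight r ≤ 6
*-weight-≤ r with r ≤? 2 | r ≤? 6
... | yes p | _     = *-monoˡ-≤ 3 p
... | no _  | yes p = *-monoˡ-≤ 1 p
... | no _  | no _  = ≤-trans (≤-reflexive (*-zeroʳ r)) z≤n

-- A 3-uniform hypergraph as a ternary relation, invariant under two transpositions that generate
-- all reorderings. `meet` forbids two edges with exactly one common vertex.
module NoBowtie {n : ℕ} (R : Fin n → Fin n → Fin n → Set) (R? : ∀ x y z → Dec (R x y z))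
  (swap₁₂ : ∀ {x y z} → R x y z → R y x z) (swap₂₃ : ∀ {x y z} → R x y z → R x z y)
  (irr : ∀ {x y z} → R x y z → x ≢ y)
  (meet : ∀ {v a b c d} → R v a b → R v c d → a ≡ c ⊎ a ≡ d ⊎ b ≡ c ⊎ b ≡ d) where

  ρ : Fin n → Fin n → Fin n → ℕ
  ρ x y z = ι (does (R? x y z))

  r : Fin n → ℕ
  r v = ∑[ a < n ] ∑[ b < n ] ρ v a b

  irr₂₃ : ∀ {x y z} → R x y z → y ≢ z
  irr₂₃ = irr ∘ swap₂₃ ∘ swap₁₂

  ρ-diag : ∀ v a → ρ v a a ≡ 0
  ρ-diag v a = cong ι (dec-false (R? v a a) λ t → irr₂₃ t refl)

  r-supported : ∀ v xs → (∀ {a b} → R v a b → a ∈ xs) →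
    r v ≤ sumˡ (map (λ a → sumˡ (map (ρ v a) xs)) xs)
  r-supported v xs supp = ≤-trans
    (sum-supported (λ a → sum (ρ v a)) xs λ a pos →
      let b , pos′ = sum>0⇒∃ (ρ v a) pos in supp (ι>0⇒ (R? v a b) pos′))
    (list-mono xs λ a → sum-supported (ρ v a) xs λ b pos → supp (swap₂₃ (ι>0⇒ (R? v a b) pos)))
    where
    list-mono : ∀ (ys : List (Fin n)) {f g : Fin n → ℕ} → (∀ a → f a ≤ g a) →
      sumˡ (map f ys) ≤ sumˡ (map g ys)
    list-mono []       f≤g = z≤n
    list-mono (y ∷ ys) f≤g = +-mono-≤ (f≤g y) (list-mono ys f≤g)

  ρ≤1 : ∀ x y z → ρ x y z ≤ 1
  ρ≤1 x y z = ι≤1 _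

  r≤2 : ∀ v a b → (∀ {x y} → R v x y → x ∈ a ∷ b ∷ []) → r v ≤ 2
  r≤2 v a b supp = ≤-trans (r-supported v (a ∷ b ∷ []) supp)
    (+-mono-≤ {_} {1} (row (ρ-diag v a) (ρ≤1 v a b))
    (+-mono-≤ {_} {1} (row′ (ρ≤1 v b a) (ρ-diag v b)) z≤n))
    where
    row : ∀ {s t} → s ≡ 0 → t ≤ 1 → s + (t + 0) ≤ 1
    row refl t≤1 = +-mono-≤ t≤1 z≤n
    row′ : ∀ {s t} → s ≤ 1 → t ≡ 0 → s + (t + 0) ≤ 1
    row′ s≤1 refl = +-mono-≤ s≤1 z≤n

  -- A 3 by 3 table with zero diagonal has six further entries, each at most 1; `exch` and `exch′`
  -- move the diagonal entry to the front of its row.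
  r≤6 : ∀ v a b c → (∀ {x y} → R v x y → x ∈ a ∷ b ∷ c ∷ []) → r v ≤ 6
  r≤6 v a b c supp = ≤-trans (r-supported v (a ∷ b ∷ c ∷ []) supp)
    (+-mono-≤ {_} {2} (row (≤-reflexive (ρ-diag v a)) (ρ≤1 v a b) (ρ≤1 v a c))
    (+-mono-≤ {_} {2} (≤-trans (≤-reflexive (exch (ρ v b a) (ρ v b b) (ρ v b c)))
                               (row (≤-reflexive (ρ-diag v b)) (ρ≤1 v b a) (ρ≤1 v b c)))
    (+-mono-≤ {_} {2} (≤-trans (≤-reflexive (exch′ (ρ v c a) (ρ v c b) (ρ v c c)))
                               (row (≤-reflexive (ρ-diag v c)) (ρ≤1 v c a) (ρ≤1 v c b))) z≤n)))
    where
    row : ∀ {s t u} → s ≤ 0 → t ≤ 1 → u ≤ 1 → s + (t + (u + 0)) ≤ 2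
    row s≤0 t≤1 u≤1 = +-mono-≤ s≤0 (+-mono-≤ t≤1 (+-mono-≤ u≤1 z≤n))
    exch : ∀ s t u → s + (t + (u + 0)) ≡ t + (s + (u + 0))
    exch = solve-∀
    exch′ : ∀ s t u → s + (t + (u + 0)) ≡ u + (s + (t + 0))
    exch′ = solve-∀

  -- By `meet`, a triangle at v other than vab contains a or b, and its remaining vertex is `c`.
  -- Without such a triangle the pairs at v use only a and b.
  extra : ∀ {v a b} → R v a b → r v ≤ 2 ⊎ ∃[ c ] (c ≢ a × c ≢ b × (R v a c ⊎ R v b c))
  extra {v} {a} {b} t
    with any? (λ c → ¬? (c ≟ᶠ a) ×-dec ¬? (c ≟ᶠ b) ×-dec (R? v a c ⊎-dec R? v b c))
  ... | yes e = inj₂ e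
  ... | no ¬e = inj₁ (r≤2 v a b supp)
    where
    supp : ∀ {x y} → R v x y → x ∈ a ∷ b ∷ []
    supp {x} {y} u with x ≟ᶠ a | x ≟ᶠ b
    ... | yes x≡a | _       = here x≡a
    ... | no _    | yes x≡b = there (here x≡b)
    ... | no x≢a  | no x≢b  with meet u t
    ...   | inj₁ x≡a                 = contradiction x≡a x≢a
    ...   | inj₂ (inj₁ x≡b)          = contradiction x≡b x≢b
    ...   | inj₂ (inj₂ (inj₁ refl))  = contradiction (x , x≢a , x≢b , inj₁ (swap₂₃ u)) ¬e
    ...   | inj₂ (inj₂ (inj₂ refl))  = contradiction (x , x≢a , x≢b , inj₂ (swap₂₃ u)) ¬e

  -- The pairs qs, qc, sc have no common element, so a triangle pxy cannot meet all three of them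
  -- through y alone; hence x is one of q, s, c.
  apex≤6 : ∀ {p q s c} → R p q s → R p q c → R p s c → r p ≤ 6
  apex≤6 {p} {q} {s} {c} t₁ t₂ t₃ = r≤6 p q s c supp
    where
    supp : ∀ {x y} → R p x y → x ∈ q ∷ s ∷ c ∷ []
    supp u with meet u t₁ | meet u t₂ | meet u t₃
    ... | inj₁ e | _ | _ = here e
    ... | inj₂ (inj₁ e) | _ | _ = there (here e)
    ... | inj₂ (inj₂ _) | inj₁ e | _ = here e
    ... | inj₂ (inj₂ _) | inj₂ (inj₁ e) | _ = there (there (here e))
    ... | inj₂ (inj₂ _) | inj₂ (inj₂ _) | inj₁ e = there (here e)
    ... | inj₂ (inj₂ _) | inj₂ (inj₂ _) | inj₂ (inj₁ e) = there (there (here e))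
    ... | inj₂ (inj₂ (inj₁ refl)) | inj₂ (inj₂ (inj₁ _)) | inj₂ (inj₂ (inj₁ e)) = contradiction e (irr₂₃ t₁)
    ... | inj₂ (inj₂ (inj₁ refl)) | inj₂ (inj₂ (inj₁ _)) | inj₂ (inj₂ (inj₂ e)) = contradiction e (irr₂₃ t₂)
    ... | inj₂ (inj₂ (inj₁ refl)) | inj₂ (inj₂ (inj₂ e)) | inj₂ (inj₂ _) = contradiction e (irr₂₃ t₂)
    ... | inj₂ (inj₂ (inj₂ refl)) | inj₂ (inj₂ (inj₁ e)) | inj₂ (inj₂ _) = contradiction (sym e) (irr₂₃ t₁)
    ... | inj₂ (inj₂ (inj₂ refl)) | inj₂ (inj₂ (inj₂ e)) | inj₂ (inj₂ _) = contradiction e (irr₂₃ t₃)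

  -- At q only the pairs ps and pc are given. Their sole common element is p, so if x lies in
  -- neither then y = p, and the triangle psc decides.
  base≤6 : ∀ {p q s c} → R p q s → R p q c → R p s c → r q ≤ 6
  base≤6 {p} {q} {s} {c} t₁ t₂ t₃ = r≤6 q p s c supp
    where
    -- A triangle q x p is also a triangle p q x, and as such meets p s c.
    via-p : ∀ {x} → R q x p → x ∈ p ∷ s ∷ c ∷ []
    via-p u with meet (swap₁₂ (swap₂₃ u)) t₃
    ... | inj₁ e               = contradiction e (irr₂₃ t₁)
    ... | inj₂ (inj₁ e)        = contradiction e (irr₂₃ t₂)
    ... | inj₂ (inj₂ (inj₁ e)) = there (here e)
    ... | inj₂ (inj₂ (inj₂ e)) = there (there (here e))
    supp : ∀ {x y} → R q x y → x ∈ p ∷ s ∷ c ∷ []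
    supp u with meet u (swap₁₂ t₁) | meet u (swap₁₂ t₂)
    ... | inj₁ e | _ = here e
    ... | inj₂ (inj₁ e) | _ = there (here e)
    ... | inj₂ (inj₂ (inj₁ refl)) | _ = via-p u
    ... | inj₂ (inj₂ (inj₂ _)) | inj₁ e = here e
    ... | inj₂ (inj₂ (inj₂ _)) | inj₂ (inj₁ e) = there (there (here e))
    ... | inj₂ (inj₂ (inj₂ _)) | inj₂ (inj₂ (inj₁ refl)) = via-p u
    ... | inj₂ (inj₂ (inj₂ refl)) | inj₂ (inj₂ (inj₂ e)) = contradiction e (irr₂₃ t₃)

  -- Further triangles on the sides pq and ps have the same third vertex: they share p, hence a
  -- second vertex, and only `c` = `c′` is possible. Then p is an apex, and q and s are bases.
  all≤6 : ∀ {p q s c c′} → R p q s → R p q c → c ≢ s → R p s c′ → c′ ≢ q →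
    r p ≤ 6 × r q ≤ 6 × r s ≤ 6
  all≤6 t₁ t₂ c≢s t₃ c′≢q with meet t₂ t₃
  ... | inj₁ e               = contradiction e (irr₂₃ t₁)
  ... | inj₂ (inj₁ e)        = contradiction (sym e) c′≢q
  ... | inj₂ (inj₂ (inj₁ e)) = contradiction e c≢s
  ... | inj₂ (inj₂ (inj₂ refl)) =
    apex≤6 t₁ t₂ t₃ , base≤6 t₁ t₂ t₃ , base≤6 (swap₂₃ t₁) t₃ t₂

  -- If each vertex lies in a further triangle, each selects a side through itself that carries one.
  -- No side contains all three vertices, so two sides are selected; their common vertex is the p of
  -- `all≤6`.
  small : ∀ {v a b} → R v a b →
    r v ≤ 2 ⊎ r a ≤ 2 ⊎ r b ≤ 2 ⊎ (r v ≤ 6 × r a ≤ 6 × r b ≤ 6)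
  small t with extra t | extra (swap₁₂ t) | extra (swap₁₂ (swap₂₃ t))
  ... | inj₁ v≤2 | _ | _ = inj₁ v≤2
  ... | inj₂ _ | inj₁ a≤2 | _ = inj₂ (inj₁ a≤2)
  ... | inj₂ _ | inj₂ _ | inj₁ b≤2 = inj₂ (inj₂ (inj₁ b≤2))
  ... | inj₂ (c , c≢a , c≢b , inj₁ vac) | inj₂ (d , d≢v , d≢b , inj₂ abd) | inj₂ _ =
    let a , v , b = all≤6 (swap₁₂ t) (swap₁₂ vac) c≢b abd d≢v in inj₂ (inj₂ (inj₂ (v , a , b)))
  -- Here v and a select the same side va, so the second side comes from b.
  ... | inj₂ (c , c≢a , c≢b , inj₁ vac) | inj₂ (d , d≢v , d≢b , inj₁ avd) | inj₂ (f , f≢v , f≢a , inj₁ bvf) =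
    inj₂ (inj₂ (inj₂ (all≤6 t vac c≢b (swap₁₂ bvf) f≢a)))
  ... | inj₂ (c , c≢a , c≢b , inj₁ vac) | inj₂ (d , d≢v , d≢b , inj₁ avd) | inj₂ (f , f≢v , f≢a , inj₂ baf) =
    let a , v , b = all≤6 (swap₁₂ t) (swap₁₂ vac) c≢b (swap₁₂ baf) f≢v in inj₂ (inj₂ (inj₂ (v , a , b)))
  ... | inj₂ (c , c≢a , c≢b , inj₂ vbc) | inj₂ (d , d≢v , d≢b , inj₁ avd) | inj₂ _ =
    inj₂ (inj₂ (inj₂ (all≤6 t (swap₁₂ avd) d≢b vbc c≢a)))
  ... | inj₂ (c , c≢a , c≢b , inj₂ vbc) | inj₂ (d , d≢v , d≢b , inj₂ abd) | inj₂ _ =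
    let b , v , a = all≤6 (swap₁₂ (swap₂₃ t)) (swap₁₂ vbc) c≢a (swap₁₂ abd) d≢v in inj₂ (inj₂ (inj₂ (v , a , b)))

  W : Fin n → ℕ
  W = weight ∘ r

  W-triangle : ∀ {v a b} → R v a b → 3 ≤ W v + (W a + W b)
  W-triangle {v} {a} {b} t with small t
  ... | inj₁ v≤2               = ≤-trans (≤-reflexive (sym (weight-small v≤2))) (m≤m+n _ _)
  ... | inj₂ (inj₁ a≤2)        = ≤-trans (≤-reflexive (sym (weight-small a≤2)))
                                   (≤-trans (m≤m+n _ _) (m≤n+m _ (W v)))
  ... | inj₂ (inj₂ (inj₁ b≤2)) = ≤-trans (≤-reflexive (sym (weight-small b≤2)))
                                   (≤-trans (m≤n+m _ (W a)) (m≤n+m _ (W v)))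
  ... | inj₂ (inj₂ (inj₂ (v≤6 , a≤6 , b≤6))) =
    +-mono-≤ (weight-medium v≤6) (+-mono-≤ (weight-medium a≤6) (weight-medium b≤6))

  ρ-swap₁₂ : ∀ x y z → ρ x y z ≡ ρ y x z
  ρ-swap₁₂ x y z = cong ι (does-⇔ (mk⇔ swap₁₂ swap₁₂) (R? x y z) (R? y x z))

  ρ-swap₂₃ : ∀ x y z → ρ x y z ≡ ρ x z y
  ρ-swap₂₃ x y z = cong ι (does-⇔ (mk⇔ swap₂₃ swap₂₃) (R? x y z) (R? x z y))

  -- Every ordered triangle has total weight at least 3. By symmetry each position contributes the
  -- same sum, so cancelling 3 leaves the sum of `r x * W x`, with terms at most 6.
  ∑³ρ≤6n : ∑³ ρ ≤ n * 6
  ∑³ρ≤6n = ≤-trans (*-cancelˡ-≤ 3 (begin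
    3 * ∑³ ρ
      ≡⟨ r₁ (∑³ ρ) ⟩
    ∑³ ρ + (∑³ ρ + ∑³ ρ)
      ≡⟨ trans (∑³-+ {n} ρ _) (cong (∑³ ρ +_) (∑³-+ {n} ρ ρ)) ⟨
    ∑³ (λ x y z → ρ x y z + (ρ x y z + ρ x y z))
      ≤⟨ ∑³-mono charge ⟩
    ∑³ (λ x y z → ρ x y z * W x + (ρ x y z * W y + ρ x y z * W z))
      ≡⟨ trans (∑³-+ {n} w₁ _) (cong (∑³ w₁ +_) (∑³-+ {n} w₂ w₃)) ⟩
    ∑³ w₁ + (∑³ w₂ + ∑³ w₃)
      ≡⟨ cong (∑³ w₁ +_) (cong₂ _+_ w₂≡w₁ (trans w₃≡w₂ w₂≡w₁)) ⟩
    ∑³ w₁ + (∑³ w₁ + ∑³ w₁)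
      ≡⟨ r₁ (∑³ w₁) ⟨
    3 * ∑³ w₁ ∎)) total
    where
    open ≤-Reasoning
    r₁ : ∀ s → 3 * s ≡ s + (s + s)
    r₁ = solve-∀
    w₁ w₂ w₃ : Fin n → Fin n → Fin n → ℕ
    w₁ x y z = ρ x y z * W x
    w₂ x y z = ρ x y z * W y
    w₃ x y z = ρ x y z * W z
    w₂≡w₁ : ∑³ w₂ ≡ ∑³ w₁
    w₂≡w₁ = trans (∑³-cong λ x y z → cong (_* W y) (ρ-swap₁₂ x y z)) (∑³-swap₁₂ w₁)
    w₃≡w₂ : ∑³ w₃ ≡ ∑³ w₂
    w₃≡w₂ = trans (∑³-cong λ x y z → cong (_* W z) (ρ-swap₂₃ x y z)) (∑³-swap₂₃ w₂)
    charge : ∀ x y z → ρ x y z + (ρ x y z + ρ x y z) ≤ w₁ x y z + (w₂ x y z + w₃ x y z)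
    charge x y z with R? x y z
    ... | no _  = z≤n
    ... | yes t rewrite *-identityˡ (W x) | *-identityˡ (W y) | *-identityˡ (W z) = W-triangle t
    row : ∀ x → sum (λ y → sum (λ z → w₁ x y z)) ≡ r x * W x
    row x = sym (trans (*-distribʳ-sum {n} (W x) _) (sum-cong-≗ λ y → *-distribʳ-sum {n} (W x) (ρ x y)))
    total : ∑³ w₁ ≤ n * 6
    total = ≤-trans (sum-mono λ x → ≤-trans (≤-reflexive (row x)) (*-weight-≤ (r x)))
                    (≤-reflexive (sum-const n 6))

-- Symmetries of rainbow triangles and the two configurations sought.

rainbow-swap₁₂ : ∀ {n} (G : EdgeColoredGraph n) {x y z} → RainbowTriangle G x y z → RainbowTriangle G y x z
rainbow-swap₁₂ G {x} {y} {z} (xy , yz , xz , c₁ , c₂ , c₃)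
  rewrite adj-sym G y x | col-sym G y x = xy , xz , yz , c₃ , c₂ ∘ sym , c₁

rainbow-swap₂₃ : ∀ {n} (G : EdgeColoredGraph n) {x y z} → RainbowTriangle G x y z → RainbowTriangle G x z y
rainbow-swap₂₃ G {x} {y} {z} (xy , yz , xz , c₁ , c₂ , c₃)
  rewrite adj-sym G z y | col-sym G z y = xz , yz , xy , c₂ ∘ sym , c₁ ∘ sym , c₃ ∘ sym

rainbow-irr : ∀ {n} (G : EdgeColoredGraph n) {x y z} → RainbowTriangle G x y z → x ≢ y
rainbow-irr G {x} (xx , _) refl = subst T (adj-irr G x) xx

SharedEdge SharedVertex : ∀ {n} → EdgeColoredGraph n → Set
SharedEdge G = ∃[ a ] ∃[ b ] ∃[ c ] ∃[ d ]
  (c ≢ d × RainbowTriangle G a b c × RainbowTriangle G a b d)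
SharedVertex G = ∃[ v ] ∃[ a ] ∃[ b ] ∃[ c ] ∃[ d ]
  (a ≢ c × a ≢ d × b ≢ c × b ≢ d × RainbowTriangle G v a b × RainbowTriangle G v c d)

outside-three : ∀ {n} → 4 ≤ n → (x y z : Fin n) → ∃[ w ] (w ≢ x × w ≢ y × w ≢ z)
outside-three {n} 4≤n x y z with any? (λ w → ¬? (w ≟ᶠ x) ×-dec ¬? (w ≟ᶠ y) ×-dec ¬? (w ≟ᶠ z))
... | yes e = e
... | no ¬e = contradiction (≤-trans 4≤n n≤3) (<-irrefl refl)
  where
  supp : ∀ w → w ∈ x ∷ y ∷ z ∷ []
  supp w with w ≟ᶠ x | w ≟ᶠ y | w ≟ᶠ z
  ... | yes e  | _      | _      = here e
  ... | no _   | yes e  | _      = there (here e)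
  ... | no _   | no _   | yes e  = there (there (here e))
  ... | no ¬e₁ | no ¬e₂ | no ¬e₃ = contradiction (w , ¬e₁ , ¬e₂ , ¬e₃) ¬e
  n≤3 : n ≤ 3
  n≤3 = subst (_≤ 3) (trans (sum-const n 1) (*-identityʳ n))
          (sum-supported (λ _ → 1) (x ∷ y ∷ z ∷ []) (λ w _ → supp w))

-- Graphs in which no two rainbow triangles share an edge.

module LoneTriangles {n : ℕ} (G : EdgeColoredGraph n) (large : ∀ v → n + 1 ≤ 2 * colorDegree G v)
  (lone : ∀ {a b c d} → RainbowTriangle G a b c → RainbowTriangle G a b d → c ≡ d) where

  open Counting G

  ρ≤A : ∀ x y z → ρ x y z ≤ A x y
  ρ≤A x y z with adj G x y
  ... | true  = ι≤1 _
  ... | false = z≤n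

  unique : ∀ x y → sum (ρ x y) ≤ A x y
  unique x y with sum (ρ x y) in eq
  ... | zero  = z≤n
  ... | suc _ with z , pos ← sum>0⇒∃ (ρ x y) (subst (0 <_) (sym eq) (s≤s z≤n)) =
    subst (_≤ A x y) eq (≤-trans (sum-supported (ρ x y) (z ∷ []) only)
      (≤-trans (≤-reflexive (+-identityʳ _)) (ρ≤A x y z)))
    where
    only : ∀ w → 0 < ρ x y w → w ∈ z ∷ []
    only w pos′ = here (lone (ι>0⇒ (rainbow? x y w) pos′) (ι>0⇒ (rainbow? x y z) pos))

  -- With at most one rainbow triangle on each ordered edge, `∑³ ρ` is at most the degree sum, and
  -- `rainbow-count` leaves no room for `β` and `κ`.
  slack≤0 : ∑³ β + ∑³ κ ≤ 0
  slack≤0 = +-cancelˡ-≤ (sum deg) _ _ (begin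
    sum deg + (∑³ β + ∑³ κ) ≤⟨ rainbow-count large ⟩
    ∑³ ρ                    ≤⟨ sum-mono (λ x → sum-mono (unique x)) ⟩
    sum deg                 ≡⟨ +-identityʳ _ ⟨
    sum deg + 0             ∎)
    where open ≤-Reasoning

  β≡0 : ∀ x y z → β x y z ≡ 0
  β≡0 x y z = n≤0⇒n≡0 (≤-trans (term≤∑³ β x y z) (≤-trans (m≤m+n _ _) slack≤0))

  κ≡0 : ∀ x y z → κ x y z ≡ 0
  κ≡0 x y z = n≤0⇒n≡0 (≤-trans (term≤∑³ κ x y z) (≤-trans (m≤n+m _ (∑³ β)) slack≤0))

  all-rainbow : ∀ {x y z} → Adj G x y → Adj G y z → Adj G x z → RainbowTriangle G x y z
  all-rainbow {x} {y} {z} xy yz xz =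
    no-clash⇒rainbow xy yz xz (β≡0 x y z) (β≡0 y x z) (β≡0 z x y)

  dominated : ∀ {x y} → Adj G x y → ∀ w → Adj G x w ⊎ Adj G y w
  dominated {x} {y} xy w = κ≡0⇒dominated xy (κ≡0 x y w)

  no-second : ∀ {x y z w} → RainbowTriangle G x y z → w ≢ z → Adj G x w → Adj G y w → ⊥
  no-second {x} {y} {z} {w} t w≢z xw yw =
    w≢z (lone (all-rainbow (proj₁ t) yw xw) t)

  -- A vertex adjacent to an end of every side is adjacent to two vertices of the triangle. With
  -- these it spans a triangle, which is rainbow since clashes are absent: a second one on that
  -- side.
  adjacent-to-two : ∀ {x y z w} → RainbowTriangle G x y z → w ≢ x → w ≢ y → w ≢ z →
    Adj G x w ⊎ Adj G y w → Adj G y w ⊎ Adj G z w → Adj G x w ⊎ Adj G z w → ⊥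
  adjacent-to-two t w≢x w≢y w≢z (inj₁ xw) (inj₁ yw) _         = no-second t w≢z xw yw
  adjacent-to-two t w≢x w≢y w≢z (inj₁ xw) (inj₂ zw) _         = no-second (rainbow-swap₂₃ G t) w≢y xw zw
  adjacent-to-two t w≢x w≢y w≢z (inj₂ yw) _         (inj₁ xw) = no-second t w≢z xw yw
  adjacent-to-two t w≢x w≢y w≢z (inj₂ yw) _         (inj₂ zw) =
    no-second (rainbow-swap₂₃ G (rainbow-swap₁₂ G t)) w≢x yw zw

  no-triangle : 4 ≤ n → ¬ (∃[ x ] ∃[ y ] ∃[ z ] 0 < ρ x y z)
  no-triangle 4≤n (x , y , z , pos) with w , w≢x , w≢y , w≢z ← outside-three 4≤n x y z
    with xyz@(xy , yz , xz , _) ← ι>0⇒ (rainbow? x y z) pos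
    = adjacent-to-two xyz w≢x w≢y w≢z (dominated xy w) (dominated yz w) (dominated xz w)

-- The two conclusions.

module _ {n : ℕ} (G : EdgeColoredGraph n) (large : ∀ v → n + 1 ≤ 2 * colorDegree G v) where

  open Counting G

  deg-large : ∀ v → n + 1 ≤ 2 * deg v
  deg-large v = ≤-trans (large v) (*-monoʳ-≤ 2 (colorDegree≤deg v))

  deg>0 : ∀ v → 0 < deg v
  deg>0 v = *-cancelˡ-< 2 0 (deg v) (≤-trans (m≤n+m 1 n) (deg-large v))

  shared-edge : 4 ≤ n → SharedEdge G
  shared-edge 4≤n with any? (λ a → any? λ b → any? λ c → any? λ d →
                              ¬? (c ≟ᶠ d) ×-dec rainbow? a b c ×-dec rainbow? a b d)
  ... | yes e = e
  ... | no ¬e = contradiction (∑³>0⇒∃ ρ ∑³ρ>0) (LoneTriangles.no-triangle G large lone 4≤n)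
    where
    lone : ∀ {a b c d} → RainbowTriangle G a b c → RainbowTriangle G a b d → c ≡ d
    lone {a} {b} {c} {d} t u = decidable-stable (c ≟ᶠ d) λ c≢d → ¬e (a , b , c , d , c≢d , t , u)
    v : Fin n
    v = fromℕ< (≤-trans (s≤s z≤n) 4≤n)
    ∑³ρ>0 : 0 < ∑³ ρ
    -- One vertex of positive degree suffices for `rainbow-count` to force a rainbow triangle.
    ∑³ρ>0 = ≤-trans (deg>0 v) (≤-trans (term≤sum deg v) (≤-trans (m≤m+n _ _) (rainbow-count large)))

  shared-vertex : 13 ≤ n → SharedVertex G
  shared-vertex 13≤n with any? (λ v → any? λ a → any? λ b → any? λ c → any? λ d →
                                ¬? (a ≟ᶠ c) ×-dec ¬? (a ≟ᶠ d) ×-dec ¬? (b ≟ᶠ c) ×-dec ¬? (b ≟ᶠ d)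
                                ×-dec rainbow? v a b ×-dec rainbow? v c d)
  ... | yes e = e
  ... | no ¬e = contradiction n*7≤n*6 (<⇒≱ (*-monoʳ-< n {{>-nonZero (≤-trans (s≤s z≤n) 13≤n)}} (n<1+n 6)))
    where
    meet : ∀ {v a b c d} → RainbowTriangle G v a b → RainbowTriangle G v c d →
      a ≡ c ⊎ a ≡ d ⊎ b ≡ c ⊎ b ≡ d
    meet {v} {a} {b} {c} {d} t u with a ≟ᶠ c | a ≟ᶠ d | b ≟ᶠ c | b ≟ᶠ d
    ... | yes e | _     | _     | _     = inj₁ e
    ... | no _  | yes e | _     | _     = inj₂ (inj₁ e)
    ... | no _  | no _  | yes e | _     = inj₂ (inj₂ (inj₁ e))
    ... | no _  | no _  | no _  | yes e = inj₂ (inj₂ (inj₂ e))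
    ... | no p  | no q  | no r  | no s  = contradiction (v , a , b , c , d , p , q , r , s , t , u) ¬e

    -- This is where 13 enters: 14 ≤ 2 * deg v puts every degree above the 6 per vertex of `∑³ρ≤6n`.
    deg≥7 : ∀ v → 7 ≤ deg v
    deg≥7 v = *-cancelˡ-≤ 2 (≤-trans (+-monoˡ-≤ 1 13≤n) (deg-large v))

    n*7≤n*6 : n * 7 ≤ n * 6
    n*7≤n*6 = begin
      n * 7                   ≡⟨ sum-const n 7 ⟨
      ∑[ v < n ] 7            ≤⟨ sum-mono deg≥7 ⟩
      sum deg                 ≤⟨ m≤m+n _ _ ⟩
      sum deg + (∑³ β + ∑³ κ) ≤⟨ rainbow-count large ⟩
      ∑³ ρ                    ≤⟨ NoBowtie.∑³ρ≤6n (RainbowTriangle G) rainbow?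
                                   (rainbow-swap₁₂ G) (rainbow-swap₂₃ G) (rainbow-irr G) meet ⟩
      n * 6                   ∎
      where open ≤-Reasoning

theorem2 : ∀ (n : ℕ) (G : EdgeColoredGraph n) →
    (∀ (v : Fin n) → n + 1 ≤ 2 * colorDegree G v) →
    ((5 ≤ n →
    ∃[ a ] ∃[ b ] ∃[ c ] ∃[ d ]
    (c ≢ d × RainbowTriangle G a b c × RainbowTriangle G a b d))
    ×
    (13 ≤ n →
    ∃[ v ] ∃[ a ] ∃[ b ] ∃[ c ] ∃[ d ]
    (a ≢ c × a ≢ d × b ≢ c × b ≢ d ×
    RainbowTriangle G v a b × RainbowTriangle G v c d)))
theorem2 n G large = (λ 5≤n → shared-edge G large (≤-trans (n≤1+n 4) 5≤n)) , shared-vertex G large
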